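{- Let $m,n$ be positive integers. Then $$\frac{m}{2(m+n)}\binom{2m}{m}\binom{2n}{n}\in\mathbb{Z}.$$ In particular, for every positive integer $n$, $$\frac{6}{n+2}\binom{2n}{n},\quad \frac{30}{n+3}\binom{2n}{n},\quad \frac{140}{n+4}\binom{2n}{n},\quad \frac{630}{n+5}\binom{2n}{n}\in\mathbb{Z}.$$
   Context: $\mathbb{Z}$ denotes the set of integers. -}

module Defs where

open import Data.Integer using (ℤ; +_)
open import Data.Nat using (ℕ; suc; NonZero; _+_; _*_)
open import Data.Nat.Combinatorics using (_C_)
open import Data.Product using (∃)
open import Data.Rational as ℚ using (ℚ)
open import Relation.Binary.PropositionalEquality using (_≡_)

IsInteger : ℚ → Set
IsInteger q = ∃ λ (z : ℤ) → q ≡ z ℚ./ 1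

centralBinomial : ℕ → ℚ
centralBinomial n = + ((2 * n) C n) ℚ./ 1

-- Denominators of the form m + n are not in constructor form, so instance
-- search does not see that they are nonzero.  This is deliberately not an
-- instance: it would compete with the library's instance at  suc k.
m+n≢0 : ∀ m n .{{_ : NonZero m}} → NonZero (m + n)
m+n≢0 (suc _) _ = _

2*[m+n]≢0 : ∀ m n .{{_ : NonZero m}} → NonZero (2 * (m + n))
2*[m+n]≢0 (suc _) _ = _

{-# OPTIONS --safe #-}
-- Write B(m) = C(2m, m).  Since (m + 1) B(m+1) = 2 (2m + 1) B(m), everything reduces to
-- m + n + 1 ∣ (2m + 1) B(m) B(n), the extra claims being the cases m = 1, 2, 3, 4.
-- For n = 0 this holds because (2m + 1) B(m) = (m + 1) C(2m + 1, m + 1).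
-- For the step from n to n + 1, put h = C(2m + 1, m + 1); then B(m + 1) = 2h and
--   (2m + 1) B(m) B(n+1) + 2 (m + n + 2) B(m+1) B(n)
--     = (2m + 3) B(m+1) B(n) + (m + n + 2) h B(n+1),
-- whose right-hand side is divisible by m + n + 2 by the case (m + 1, n).
module Submission where

open import Defs
open import Data.Integer using (+_)
import Data.Integer as ℤ
import Data.Integer.Properties as ℤ
open import Data.Nat using (ℕ; zero; suc; NonZero; _+_; _*_; _∸_)
open import Data.Nat.Combinatorics using (_C_; nCk+nC[k+1]≡[n+1]C[k+1]; nCk≡nC[n∸k])
open import Data.Nat.Divisibility
open import Data.Nat.Properties
open import Data.Nat.Tactic.RingSolver using (solve-∀)
open import Data.Product using (_×_; _,_)
open import Data.Rational as ℚ using (_/_; toℚᵘ; fromℚᵘ)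
open import Data.Rational.Properties
  using (toℚᵘ-injective; toℚᵘ-homo-*; toℚᵘ-fromℚᵘ; fromℚᵘ-cong; /-cong)
import Data.Rational.Unnormalised as ℚᵘ
import Data.Rational.Unnormalised.Properties as ℚᵘ
open import Relation.Binary.PropositionalEquality
open ≡-Reasoning

-- Absorption identity, by induction on `n`. Pascal's rule splits the left side, and taking one copy
-- of `x` out of the factor `2 + k` leaves exactly the cases `k` and `suc k` of row `n`. Pascal's
-- rule then recombines their right-hand sides into one more multiple of `x`.
[k+1]*[n+1]C[k+1]≡[n+1]*nCk : ∀ n k → suc k * (suc n C suc k) ≡ suc n * (n C k)
[k+1]*[n+1]C[k+1]≡[n+1]*nCk zero zero = refl
[k+1]*[n+1]C[k+1]≡[n+1]*nCk zero (suc k) = *-zeroʳ (2 + k)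
[k+1]*[n+1]C[k+1]≡[n+1]*nCk (suc n) zero = begin
  1 * (suc (suc n) C 1)                ≡⟨ cong (1 *_) (nCk+nC[k+1]≡[n+1]C[k+1] (suc n) 0) ⟨
  1 * (1 + (suc n C 1))                ≡⟨ *-distribˡ-+ 1 1 (suc n C 1) ⟩
  1 + 1 * (suc n C 1)                  ≡⟨ cong suc ([k+1]*[n+1]C[k+1]≡[n+1]*nCk n 0) ⟩
  suc (suc n) * (suc n C 0)            ∎
[k+1]*[n+1]C[k+1]≡[n+1]*nCk (suc n) (suc k) = begin
  suc (suc k) * (suc (suc n) C suc (suc k))
    ≡⟨ cong (suc (suc k) *_) (nCk+nC[k+1]≡[n+1]C[k+1] (suc n) (suc k)) ⟨
  suc (suc k) * (x + (suc n C suc (suc k)))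
    ≡⟨ split k x (suc n C suc (suc k)) ⟩
  x + (suc k * x + suc (suc k) * (suc n C suc (suc k)))
    ≡⟨ cong (_+_ x) (cong₂ _+_ ([k+1]*[n+1]C[k+1]≡[n+1]*nCk n k) ([k+1]*[n+1]C[k+1]≡[n+1]*nCk n (suc k))) ⟩
  x + (suc n * (n C k) + suc n * (n C suc k))
    ≡⟨ cong (_+_ x) (*-distribˡ-+ (suc n) (n C k) (n C suc k)) ⟨
  x + suc n * ((n C k) + (n C suc k))
    ≡⟨ cong (λ y → x + suc n * y) (nCk+nC[k+1]≡[n+1]C[k+1] n k) ⟩
  suc (suc n) * x ∎
  where
  x = suc n C suc k
  split : ∀ k x y → (2 + k) * (x + y) ≡ x + ((1 + k) * x + (2 + k) * y)
  split = solve-∀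

B H : ℕ → ℕ
B n = (2 * n) C n
H n = suc (2 * n) C suc n

[n+1]*Hn≡[2n+1]*Bn : ∀ n → suc n * H n ≡ suc (2 * n) * B n
[n+1]*Hn≡[2n+1]*Bn n = [k+1]*[n+1]C[k+1]≡[n+1]*nCk (2 * n) n

-- Pascal's rule gives the sum of the two middle entries of row `2n + 1`, which are equal by
-- symmetry.
B[n+1]≡2*Hn : ∀ n → B (suc n) ≡ 2 * H n
B[n+1]≡2*Hn n = begin
  (2 * suc n) C suc n                        ≡⟨ cong (_C suc n) (*-suc 2 n) ⟩
  suc (suc (2 * n)) C suc n                  ≡⟨ nCk+nC[k+1]≡[n+1]C[k+1] (suc (2 * n)) n ⟨
  (suc (2 * n) C n) + H n                    ≡⟨ cong (_+ H n) (nCk≡nC[n∸k] n≤1+2n) ⟩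
  (suc (2 * n) C (suc (2 * n) ∸ n)) + H n    ≡⟨ cong (λ k → (suc (2 * n) C k) + H n) 1+2n∸n≡1+n ⟩
  H n + H n                                  ≡⟨ cong (_+_ (H n)) (+-identityʳ (H n)) ⟨
  2 * H n                                    ∎
  where
  n≤1+2n = m≤n⇒m≤1+n (m≤m+n n (n + 0))
  1+2n∸n≡1+n : suc (2 * n) ∸ n ≡ suc n
  1+2n∸n≡1+n = begin
    suc (n + (n + 0)) ∸ n  ≡⟨ cong (λ k → suc (n + k) ∸ n) (+-identityʳ n) ⟩
    suc n + n ∸ n          ≡⟨ m+n∸n≡m (suc n) n ⟩
    suc n                  ∎

[n+1]*B[n+1]≡2*[2n+1]*Bn : ∀ n → suc n * B (suc n) ≡ 2 * (suc (2 * n) * B n)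
[n+1]*B[n+1]≡2*[2n+1]*Bn n = begin
  suc n * B (suc n)         ≡⟨ cong (suc n *_) (B[n+1]≡2*Hn n) ⟩
  suc n * (2 * H n)         ≡⟨ x∙yz≈y∙xz (suc n) 2 (H n) ⟩
  2 * (suc n * H n)         ≡⟨ cong (2 *_) ([n+1]*Hn≡[2n+1]*Bn n) ⟩
  2 * (suc (2 * n) * B n)   ∎
  where open import Algebra.Properties.CommutativeSemigroup *-commutativeSemigroup using (x∙yz≈y∙xz)

exchange : ∀ m n →
  (2 + m + n) * (2 * (B (suc m) * B n)) + suc (2 * m) * (B m * B (suc n))
    ≡ suc (2 * suc m) * (B (suc m) * B n) + (2 + m + n) * (H m * B (suc n))
exchange m n = begin
  (2 + m + n) * (2 * (B (suc m) * b)) + suc (2 * m) * (B m * b′)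
    ≡⟨ cong (_+_ ((2 + m + n) * (2 * (B (suc m) * b)))) (*-assoc (suc (2 * m)) (B m) b′) ⟨
  (2 + m + n) * (2 * (B (suc m) * b)) + suc (2 * m) * B m * b′
    ≡⟨ cong₂ (λ x y → (2 + m + n) * (2 * (x * b)) + y * b′) (B[n+1]≡2*Hn m) (sym ([n+1]*Hn≡[2n+1]*Bn m)) ⟩
  (2 + m + n) * (2 * (2 * h * b)) + suc m * h * b′
    -- Uses `2(m + n + 2) = (2m + 3) + (2n + 1)`; the second summand is what the recurrence for `b′`
    -- absorbs.
    ≡⟨ regroupˡ m n h b b′ ⟩
  suc (2 * suc m) * (2 * h * b) + suc m * h * b′ + h * (2 * (suc (2 * n) * b))
    ≡⟨ cong (λ x → suc (2 * suc m) * (2 * h * b) + suc m * h * b′ + h * x) ([n+1]*B[n+1]≡2*[2n+1]*Bn n) ⟨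
  suc (2 * suc m) * (2 * h * b) + suc m * h * b′ + h * (suc n * b′)
    -- The coefficients `m + 1` and `n + 1` of `h * b′` add up to the modulus.
    ≡⟨ regroupʳ m n h b b′ ⟩
  suc (2 * suc m) * (2 * h * b) + (2 + m + n) * (h * b′)
    ≡⟨ cong (λ x → suc (2 * suc m) * (x * b) + (2 + m + n) * (h * b′)) (B[n+1]≡2*Hn m) ⟨
  suc (2 * suc m) * (B (suc m) * b) + (2 + m + n) * (h * b′) ∎
  where
  h = H m
  b = B n
  b′ = B (suc n)
  regroupˡ : ∀ m n h b b′ →
    (2 + m + n) * (2 * (2 * h * b)) + (1 + m) * h * b′
      ≡ (1 + 2 * (1 + m)) * (2 * h * b) + (1 + m) * h * b′ + h * (2 * ((1 + 2 * n) * b))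
  regroupˡ = solve-∀
  regroupʳ : ∀ m n h b b′ →
    (1 + 2 * (1 + m)) * (2 * h * b) + (1 + m) * h * b′ + h * ((1 + n) * b′)
      ≡ (1 + 2 * (1 + m)) * (2 * h * b) + (2 + m + n) * (h * b′)
  regroupʳ = solve-∀

1+m+n∣[2m+1]*Bm*Bn : ∀ m n → suc (m + n) ∣ suc (2 * m) * (B m * B n)
1+m+n∣[2m+1]*Bm*Bn m zero = divides (H m) (begin
  suc (2 * m) * (B m * 1)  ≡⟨ cong (suc (2 * m) *_) (*-identityʳ (B m)) ⟩
  suc (2 * m) * B m        ≡⟨ [n+1]*Hn≡[2n+1]*Bn m ⟨
  suc m * H m              ≡⟨ *-comm (suc m) (H m) ⟩
  H m * suc m              ≡⟨ cong (λ k → H m * suc k) (+-identityʳ m) ⟨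
  H m * suc (m + 0)        ∎)
-- After the rewrite the modulus is `2 + m + n`, the same as in the case `(suc m, n)`: the recursion
-- lowers `n` and raises `m`, so `m` has to vary. The first term of `exchange` is a visible multiple
-- of the modulus and cancels.
1+m+n∣[2m+1]*Bm*Bn m (suc n) rewrite +-suc m n =
  ∣m+n∣m⇒∣n
    (subst (2 + m + n ∣_) (sym (exchange m n))
      (∣m∣n⇒∣m+n (1+m+n∣[2m+1]*Bm*Bn (suc m) n) (m∣m*n (H m * B (suc n)))))
    (m∣m*n (2 * (B (suc m) * B n)))

-- For the predecessor of `m`, the recurrence for `B` produces the factor 2 of the divisor and the
-- coefficient `2m + 1` of the previous lemma.
2*[m+n]∣m*Bm*Bn : ∀ m n .{{_ : NonZero m}} → 2 * (m + n) ∣ m * B m * B n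
2*[m+n]∣m*Bm*Bn (suc m) n = subst (2 * (suc m + n) ∣_) (sym eq)
  (*-monoʳ-∣ 2 (1+m+n∣[2m+1]*Bm*Bn m n))
  where
  reassoc : ∀ c x y → 2 * (c * x) * y ≡ 2 * (c * (x * y))
  reassoc = solve-∀
  eq : suc m * B (suc m) * B n ≡ 2 * (suc (2 * m) * (B m * B n))
  eq = trans (cong (_* B n) ([n+1]*B[n+1]≡2*[2n+1]*Bn m)) (reassoc (suc (2 * m)) (B m) (B n))

n+1+m∣[2m+1]*Bm*Bn : ∀ m n → n + suc m ∣ suc (2 * m) * B m * B n
n+1+m∣[2m+1]*Bm*Bn m n =
  subst₂ _∣_ (+-comm (suc m) n) (sym (*-assoc (suc (2 * m)) (B m) (B n))) (1+m+n∣[2m+1]*Bm*Bn m n)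

fromℚᵘ-homo-* : ∀ p q → fromℚᵘ (p ℚᵘ.* q) ≡ fromℚᵘ p ℚ.* fromℚᵘ q
fromℚᵘ-homo-* p q = toℚᵘ-injective (ℚᵘ.≃-trans (toℚᵘ-fromℚᵘ (p ℚᵘ.* q)) (ℚᵘ.≃-sym
  (ℚᵘ.≃-trans (toℚᵘ-homo-* (fromℚᵘ p) (fromℚᵘ q)) (ℚᵘ.*-cong (toℚᵘ-fromℚᵘ p) (toℚᵘ-fromℚᵘ q)))))

-- For a successor `d`, `+ a / d` is by definition `fromℚᵘ` of an unreduced fraction, so the product
-- is computed there and no gcd has to be handled.
/-*-/1 : ∀ a d b .{{_ : NonZero d}} → (+ a / d) ℚ.* (+ b / 1) ≡ + (a * b) / d
/-*-/1 a d@(suc d-1) b = begin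
  (+ a / d) ℚ.* (+ b / 1)    ≡⟨ fromℚᵘ-homo-* (ℚᵘ.mkℚᵘ (+ a) d-1) (ℚᵘ.mkℚᵘ (+ b) 0) ⟨
  (+ a ℤ.* + b) / (d * 1)    ≡⟨ /-cong (sym (ℤ.pos-* a b)) (*-identityʳ d) ⟩
  + (a * b) / d              ∎

∣⇒IsInteger : ∀ {d a} .{{_ : NonZero d}} → d ∣ a → IsInteger (+ a / d)
∣⇒IsInteger {d@(suc d-1)} (divides-refl q) =
  + q , fromℚᵘ-cong {ℚᵘ.mkℚᵘ (+ (q * d)) d-1} {ℚᵘ.mkℚᵘ (+ q) 0}
          (ℚᵘ.*≡* (trans (ℤ.*-identityʳ (+ (q * d))) (ℤ.pos-* q d)))

∣⇒IsInteger-* : ∀ a d b .{{_ : NonZero d}} → d ∣ a * b → IsInteger ((+ a / d) ℚ.* (+ b / 1))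
∣⇒IsInteger-* a d b d∣ab = subst IsInteger (sym (/-*-/1 a d b)) (∣⇒IsInteger d∣ab)

corollary1p5 : ((m n : ℕ) .{{_ : NonZero m}} .{{_ : NonZero n}} →
    IsInteger ((+ m / (2 * (m + n))) {{2*[m+n]≢0 m n}} ℚ.* centralBinomial m ℚ.* centralBinomial n))
    ×
    ((n : ℕ) .{{_ : NonZero n}} →
    IsInteger ((+ 6 / (n + 2)) {{m+n≢0 n 2}} ℚ.* centralBinomial n)
    × IsInteger ((+ 30 / (n + 3)) {{m+n≢0 n 3}} ℚ.* centralBinomial n)
    × IsInteger ((+ 140 / (n + 4)) {{m+n≢0 n 4}} ℚ.* centralBinomial n)
    × IsInteger ((+ 630 / (n + 5)) {{m+n≢0 n 5}} ℚ.* centralBinomial n))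
corollary1p5 =
  (λ m n →
    -- The product associates to the left, so `B m` is first merged into the numerator.
    subst (λ q → IsInteger (q ℚ.* centralBinomial n))
      (sym (/-*-/1 m (2 * (m + n)) (B m) {{2*[m+n]≢0 m n}}))
      (∣⇒IsInteger-* (m * B m) (2 * (m + n)) (B n) {{2*[m+n]≢0 m n}} (2*[m+n]∣m*Bm*Bn m n))) ,
  λ n →
    -- The constants are the values of `suc (2 * m) * B m` at 1, 2, 3, 4: 3·2, 5·6, 7·20 and 9·70.
    ∣⇒IsInteger-* 6 (n + 2) (B n) {{m+n≢0 n 2}} (n+1+m∣[2m+1]*Bm*Bn 1 n) ,
    ∣⇒IsInteger-* 30 (n + 3) (B n) {{m+n≢0 n 3}} (n+1+m∣[2m+1]*Bm*Bn 2 n) ,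
    ∣⇒IsInteger-* 140 (n + 4) (B n) {{m+n≢0 n 4}} (n+1+m∣[2m+1]*Bm*Bn 3 n) ,
    ∣⇒IsInteger-* 630 (n + 5) (B n) {{m+n≢0 n 5}} (n+1+m∣[2m+1]*Bm*Bn 4 n)
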